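{- Let $k \ge 5$ be an integer and let $G^F(k) = (C \cup (V\setminus C), E)$ be any graph with vertex set $V$ and $C\subseteq V$ such that $|C|=k$, the induced subgraph $G^F(k)[C]$ has neither open nor closed twins, and $V\setminus C$ consists of exactly one vertex $v_{C'}$ with $N(v_{C'})\cap C=C'$ for each non-empty subset $C'\subseteq C$ such that there is no vertex $u\in C$ with either $N(u)\cap C=C'$ or $N[u]\cap C=C'$ (with no condition on the edges inside $V\setminus C$). Then in $G^F(k)$, the set $C$ is a minimum-cardinality (i) FD-code; (ii) FTD-code if $G^F(k)[C]$ has no isolated vertex, that is, if $G^F(k)[C]$ is FTD-admissible. Moreover, for $X \in \{\mathrm{FD}, \mathrm{FTD}\}$, the minimum X-density among all X-admissible graphs with X-number $k$ is attained by the graphs $G^F(k)$ for which $G^F(k)[C]$ has an isolated vertex if $X=\mathrm{FD}$, and by those graphs $G^F(k)$ for which $G^F(k)[C]$ has no isolated vertex if $X=\mathrm{FTD}$.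
   Context: Graphs are finite, simple and undirected. For a graph $G=(V,E)$ and $v\in V$, $N(v)$ is the open neighborhood and $N[v]=N(v)\cup\{v\}$ the closed neighborhood; $G[C]$ is the subgraph induced by $C$. Open twins are distinct non-adjacent vertices $u,v$ with $N(u)=N(v)$; closed twins are distinct adjacent vertices $u,v$ with $N[u]=N[v]$. A set $C\subseteq V$ is dominating (resp. total-dominating) if $N[v]\cap C\neq\emptyset$ (resp. $N(v)\cap C\ne\emptyset$) for all $v\in V$. A set $C$ is full-separating if $N(u)\cap C\neq N(v)\cap C$ and $N[u]\cap C\neq N[v]\cap C$ for all distinct $u,v\in V$. An FD-code (resp. FTD-code) is a set that is full-separating and dominating (resp. total-dominating). A graph is X-admissible if it has an X-code; the X-number $\gamma^{X}(G)$ of an X-admissible graph is the minimum cardinality of an X-code of $G$. The X-density of an X-admissible graph $G$ on $n$ vertices is $\gamma^{X}(G)/n$. -}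

module Defs where

open import Data.Bool.Base using (Bool; true; false; T)
open import Data.Fin.Base using (Fin; zero; suc)
open import Data.Fin.Subset
open import Data.Integer.Base using (+_)
open import Data.Nat.Base as ℕ using (ℕ; NonZero)
open import Data.Product using (_×_; ∃; ∃-syntax; Σ-syntax; ∃!)
open import Data.Rational.Base as ℚ using (ℚ; _/_)
open import Data.Vec.Base using ([]; _∷_; tabulate)
open import Relation.Binary.PropositionalEquality using (_≡_; _≢_)
open import Relation.Nullary.Negation using (¬_)

record Graph : Set where
  field
    order       : ℕ
    adjacent    : Fin order → Fin order → Bool
    symmetric   : ∀ u v → adjacent u v ≡ adjacent v u
    irreflexive : ∀ v → adjacent v v ≡ false

  Vertex : Set
  Vertex = Fin order

  VertexSet : Set
  VertexSet = Subset order

  Adj : Vertex → Vertex → Set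
  Adj u v = T (adjacent u v)

  N : Vertex → VertexSet
  N v = tabulate (adjacent v)

  N[_] : Vertex → VertexSet
  N[ v ] = N v ∪ ⁅ v ⁆

  OpenTwins : Vertex → Vertex → Set
  OpenTwins u v = u ≢ v × ¬ Adj u v × N u ≡ N v

  ClosedTwins : Vertex → Vertex → Set
  ClosedTwins u v = u ≢ v × Adj u v × N[ u ] ≡ N[ v ]

  Isolated : Vertex → Set
  Isolated v = Empty (N v)

  Dominating : VertexSet → Set
  Dominating C = ∀ v → Nonempty (N[ v ] ∩ C)

  TotalDominating : VertexSet → Set
  TotalDominating C = ∀ v → Nonempty (N v ∩ C)

  FullSeparating : VertexSet → Set
  FullSeparating C =
    ∀ u v → u ≢ v → N u ∩ C ≢ N v ∩ C × N[ u ] ∩ C ≢ N[ v ] ∩ C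

HasIsolatedVertex : Graph → Set
HasIsolatedVertex G = ∃[ v ] Graph.Isolated G v

TwinFree : Graph → Set
TwinFree G = ∀ u v → ¬ OpenTwins u v × ¬ ClosedTwins u v
  where open Graph G

-- The increasing enumeration of the elements of a subset.
element : ∀ {n} (C : Subset n) → Fin ∣ C ∣ → Fin n
element (true  ∷ C) zero    = zero
element (true  ∷ C) (suc i) = suc (element C i)
element (false ∷ C) i       = suc (element C i)

-- Vertex i of the induced subgraph stands for vertex element C i of G.
induced : (G : Graph) → Graph.VertexSet G → Graph
induced G C = record
  { order       = ∣ C ∣
  ; adjacent    = λ i j → adjacent (element C i) (element C j)
  ; symmetric   = λ i j → symmetric (element C i) (element C j)
  ; irreflexive = λ i → irreflexive (element C i)
  }
  where open Graph G

data CodeType : Set where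
  FD FTD : CodeType

IsCode : CodeType → (G : Graph) → Graph.VertexSet G → Set
IsCode FD  G C = Graph.FullSeparating G C × Graph.Dominating G C
IsCode FTD G C = Graph.FullSeparating G C × Graph.TotalDominating G C

Admissible : CodeType → Graph → Set
Admissible X G = ∃[ C ] IsCode X G C

IsMinimumCode : CodeType → (G : Graph) → Graph.VertexSet G → Set
IsMinimumCode X G C = IsCode X G C × (∀ D → IsCode X G D → ∣ C ∣ ℕ.≤ ∣ D ∣)

-- HasNumber X G m: the graph G is X-admissible and its X-number is m.
HasNumber : CodeType → Graph → ℕ → Set
HasNumber X G m = ∃[ C ] IsMinimumCode X G C × ∣ C ∣ ≡ m

-- HasDensity X G q: the graph G is non-null and X-admissible, and its
-- X-density is q.
HasDensity : CodeType → Graph → ℚ → Set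
HasDensity X G q =
  ∃[ m ] HasNumber X G m ×
         (Σ[ nz ∈ NonZero order ] q ≡ _/_ (+ m) order {{nz}})
  where open Graph G

-- Among all X-admissible graphs with X-number k, the minimum X-density
-- exists and is attained by G.
AttainsMinimumDensity : CodeType → ℕ → Graph → Set
AttainsMinimumDensity X k G =
  HasNumber X G k ×
  (∃[ q ] HasDensity X G q ×
          (∀ H r → HasNumber X H k → HasDensity X H r → q ℚ.≤ r))

-- IsGF k G C: the graph G, with distinguished vertex set C, is a graph
-- G^F(k).
record IsGF (k : ℕ) (G : Graph) (C : Graph.VertexSet G) : Set where
  open Graph G

  -- The subsets C′ of C for which there is a vertex v_{C′} outside C.
  IsOuterTrace : VertexSet → Set
  IsOuterTrace C′ =
    C′ ⊆ C × Nonempty C′ ×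
    (∀ u → u ∈ C → N u ∩ C ≢ C′ × N[ u ] ∩ C ≢ C′)

  field
    size     : ∣ C ∣ ≡ k
    twinFree : TwinFree (induced G C)
    outer    : ∀ v → v ∉ C → IsOuterTrace (N v ∩ C)
    vertexOf : ∀ C′ → IsOuterTrace C′ → ∃! _≡_ (λ v → v ∉ C × N v ∩ C ≡ C′)

{-# OPTIONS --safe #-}

-- For a full-separating set C of a graph with n vertices, the traces on C of the n open
-- neighbourhoods and of the |C| closed neighbourhoods of vertices of C are pairwise distinct subsets
-- of C, so n + |C| ≤ 2 ^ |C|. The empty set is never a trace if C is total-dominating, which improves
-- the bound by one. In a graph G^F(k) every non-empty subset of C is a trace, and the empty set is
-- one exactly when C has an isolated vertex, so the two bounds are equalities. As m ↦ 2 ^ m ∸ m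
-- grows fast enough, such a graph has too many vertices to have a code of fewer than k elements.
-- The path on k vertices, and the path on k ∸ 1 vertices with an isolated vertex added, are
-- twin-free, so both kinds of graphs G^F(k) exist.

module Submission where

open import Defs
open import Data.Bool.Base using (Bool; true; false; T; _∧_; _∨_)
open import Data.Bool.Properties as Bool using (∨-identityʳ; T-≡)
open import Data.Fin.Base using (Fin; zero; suc; splitAt; join; _↑ˡ_; _↑ʳ_; combine; funToFin; finToFun)
open import Data.Fin.Properties
  using (2↔Bool; suc-injective; any?; all?; injective⇒≤; funToFin-finToFin; finToFun-funToFin;
         join-splitAt; splitAt-join; splitAt-↑ˡ; splitAt-↑ʳ)
  renaming (_≟_ to _≟ᶠ_)
open import Data.Fin.Subset
open import Data.Fin.Subset.Properties
open import Data.Integer.Base using (+≤+) renaming (+_ to pos; _≤_ to _≤ℤ_)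
open import Data.Integer.Properties using (pos-*)
open import Data.Nat.Base using (ℕ; zero; suc; NonZero; >-nonZero; ≤′-refl; ≤′-step; _+_; _*_; _^_; _≤_; _<_; z≤n; s≤s; s≤s⁻¹)
open import Data.Nat.Properties hiding (suc-injective; _≟_)
open import Data.Product using (_×_; ∃-syntax; ∃!; _,_; proj₁; proj₂)
open import Data.Rational.Base as ℚ using (_/_)
import Data.Rational.Properties as ℚ
import Data.Rational.Unnormalised.Base as ℚᵘ
import Data.Rational.Unnormalised.Properties as ℚᵘ
open import Data.Sum.Base as Sum using (_⊎_; inj₁; inj₂)
open import Data.Vec.Base as Vec using ([]; _∷_; _++_; lookup; tabulate; here; there)
open import Data.Vec.Properties
  using (∷-injectiveʳ; ≡-dec; lookup∘tabulate; tabulate∘lookup; tabulate-cong;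
         []=⇒lookup; lookup⇒[]=; zipWith-++; ++-injectiveˡ; lookup-++ˡ; lookup-++ʳ; lookup-zipWith)
open import Function.Base using (_∘_; id)
open import Function.Bundles using (_⇔_; mk⇔; Equivalence; Inverse)
open import Function.Definitions using (Injective)
open import Relation.Binary.PropositionalEquality
open import Relation.Nullary.Decidable using (Dec; yes; no; isYes; ¬?; _×-dec_; toWitness; fromWitness; decidable-stable)
open import Relation.Nullary.Negation using (¬_; contradiction)

private
  variable
    m n p : ℕ

-- Subsets of a finite set, and counting them by pigeonhole.

_≟_ : (P Q : Subset n) → Dec (P ≡ Q)
_≟_ = ≡-dec Bool._≟_

∉⇒lookup≡false : {P : Subset n} {x : Fin n} → x ∉ P → lookup P x ≡ false
∉⇒lookup≡false {P = P} {x} x∉P with lookup P x in eq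
... | true  = contradiction (lookup⇒[]= x P eq) x∉P
... | false = refl

∈-tabulate⁺ : {f : Fin n → Bool} {x : Fin n} → T (f x) → x ∈ tabulate f
∈-tabulate⁺ {f = f} {x} fx =
  lookup⇒[]= x _ (trans (lookup∘tabulate f x) (Equivalence.to T-≡ fx))

∈-tabulate⁻ : {f : Fin n → Bool} {x : Fin n} → x ∈ tabulate f → T (f x)
∈-tabulate⁻ {f = f} {x} x∈ =
  Equivalence.from T-≡ (trans (sym (lookup∘tabulate f x)) ([]=⇒lookup x∈))

funToFin-cong : {f g : Fin m → Fin n} → f ≗ g → funToFin f ≡ funToFin g
funToFin-cong {zero}  f≗g = refl
funToFin-cong {suc m} f≗g = cong₂ combine (f≗g zero) (funToFin-cong (f≗g ∘ suc))

encode : Subset n → Fin (2 ^ n)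
encode P = funToFin (Inverse.from 2↔Bool ∘ lookup P)

decode : Fin (2 ^ n) → Subset n
decode c = tabulate (Inverse.to 2↔Bool ∘ finToFun c)

decode-encode : (P : Subset n) → decode (encode P) ≡ P
decode-encode P = trans
  (tabulate-cong λ i → Inverse.inverseˡ 2↔Bool (finToFun-funToFin (Inverse.from 2↔Bool ∘ lookup P) i))
  (tabulate∘lookup P)

encode-decode : (c : Fin (2 ^ n)) → encode {n} (decode c) ≡ c
encode-decode {n} c = trans
  (funToFin-cong λ i → Inverse.inverseʳ 2↔Bool (lookup∘tabulate (Inverse.to 2↔Bool ∘ finToFun {2} {n} c) i))
  (funToFin-finToFin {n} c)

encode-injective : Injective _≡_ _≡_ (encode {n})
encode-injective eq = trans (sym (decode-encode _)) (trans (cong decode eq) (decode-encode _))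

decode-injective : Injective _≡_ _≡_ (decode {n})
decode-injective {n} {c} {d} eq =
  trans (sym (encode-decode {n} c)) (trans (cong encode eq) (encode-decode {n} d))

injective⇒+≤2^ : {f : Fin m ⊎ Fin n → Subset p} → Injective _≡_ _≡_ f → m + n ≤ 2 ^ p
injective⇒+≤2^ {m} {n} {f = f} inj = injective⇒≤ {f = encode ∘ f ∘ splitAt m} λ {i} {j} eq →
  trans (sym (join-splitAt m n i))
    (trans (cong (join m n) (inj (encode-injective eq))) (join-splitAt m n j))

-- Choosing a preimage of each subset is injective, because `f` recovers the subset from the choice.
surjective⇒2^≤+ : {f : Fin m ⊎ Fin n → Subset p} → (∀ P → ∃[ x ] f x ≡ P) → 2 ^ p ≤ m + n
surjective⇒2^≤+ {m} {n} {p} {f} surj = injective⇒≤ {f = join m n ∘ preimage} λ {c} {d} eq →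
  decode-injective {p} (trans (sym (proj₂ (surj (decode c)))) (trans
    (cong f (trans (sym (splitAt-join m n _)) (trans (cong (splitAt m) eq) (splitAt-join m n _))))
    (proj₂ (surj (decode d)))))
  where
  preimage : Fin (2 ^ p) → Fin m ⊎ Fin n
  preimage c = proj₁ (surj (decode c))

-- Enumerating a subset and restricting other subsets to it.

element-injective : (C : Subset n) → Injective _≡_ _≡_ (element C)
element-injective (true  ∷ C) {zero}  {zero}  _  = refl
element-injective (true  ∷ C) {suc i} {suc j} eq = cong suc (element-injective C (suc-injective eq))
element-injective (false ∷ C) eq = element-injective C (suc-injective eq)

element-∈ : (C : Subset n) (i : Fin ∣ C ∣) → element C i ∈ C
element-∈ (true  ∷ C) zero    = here
element-∈ (true  ∷ C) (suc i) = there (element-∈ C i)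
element-∈ (false ∷ C) i       = there (element-∈ C i)

∈⇒element : (C : Subset n) {x : Fin n} → x ∈ C → ∃[ i ] element C i ≡ x
∈⇒element (true  ∷ C) here        = zero , refl
∈⇒element (true  ∷ C) (there x∈C) = let i , eq = ∈⇒element C x∈C in suc i , cong suc eq
∈⇒element (false ∷ C) (there x∈C) = let i , eq = ∈⇒element C x∈C in i , cong suc eq

-- The isomorphism between subsets of the set C and sets of positions in its enumeration.
restrict : (C : Subset n) → Subset n → Subset ∣ C ∣
restrict []          []      = []
restrict (true  ∷ C) (s ∷ S) = s ∷ restrict C S
restrict (false ∷ C) (s ∷ S) = restrict C S

extend : (C : Subset n) → Subset ∣ C ∣ → Subset n
extend []          []      = []
extend (true  ∷ C) (s ∷ S) = s ∷ extend C S
extend (false ∷ C) S       = false ∷ extend C S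

restrict-∩ : (C S : Subset n) → restrict C (S ∩ C) ≡ restrict C S
restrict-∩ []          []          = refl
restrict-∩ (true  ∷ C) (s ∷ S)     = cong₂ _∷_ (Bool.∧-identityʳ s) (restrict-∩ C S)
restrict-∩ (false ∷ C) (s ∷ S)     = restrict-∩ C S

extend-restrict : (C S : Subset n) → extend C (restrict C S) ≡ S ∩ C
extend-restrict []          []      = refl
extend-restrict (true  ∷ C) (s ∷ S) = cong₂ _∷_ (sym (Bool.∧-identityʳ s)) (extend-restrict C S)
extend-restrict (false ∷ C) (s ∷ S) = cong₂ _∷_ (sym (Bool.∧-zeroʳ s)) (extend-restrict C S)

restrict-extend : (C : Subset n) (P : Subset ∣ C ∣) → restrict C (extend C P) ≡ P
restrict-extend []          []      = refl
restrict-extend (true  ∷ C) (s ∷ P) = cong (s ∷_) (restrict-extend C P)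
restrict-extend (false ∷ C) P       = restrict-extend C P

extend-⊆ : (C : Subset n) (P : Subset ∣ C ∣) → extend C P ⊆ C
extend-⊆ (true  ∷ C) (_ ∷ P) here      = here
extend-⊆ (true  ∷ C) (_ ∷ P) (there x) = there (extend-⊆ C P x)
extend-⊆ (false ∷ C) P       (there x) = there (extend-⊆ C P x)

-- Links the two forms of a trace: `S ∩ C`, in which separation is stated, and `restrict C S`, which
-- lives in a type with `2 ^ ∣ C ∣` elements and can be counted.
restrict-≡⇒∩-≡ : (C : Subset n) {S S′ : Subset n} → restrict C S ≡ restrict C S′ → S ∩ C ≡ S′ ∩ C
restrict-≡⇒∩-≡ C {S} {S′} eq =
  trans (sym (extend-restrict C S)) (trans (cong (extend C) eq) (extend-restrict C S′))

∩-≡⇒restrict-≡ : (C : Subset n) {S S′ : Subset n} → S ∩ C ≡ S′ ∩ C → restrict C S ≡ restrict C S′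
∩-≡⇒restrict-≡ C {S} {S′} eq =
  trans (sym (restrict-∩ C S)) (trans (cong (restrict C) eq) (restrict-∩ C S′))

restrict-tabulate : (C : Subset n) (f : Fin n → Bool) → restrict C (tabulate f) ≡ tabulate (f ∘ element C)
restrict-tabulate []          f = refl
restrict-tabulate (true  ∷ C) f = cong (f zero ∷_) (restrict-tabulate C (f ∘ suc))
restrict-tabulate (false ∷ C) f = restrict-tabulate C (f ∘ suc)

restrict-∪ : (C S S′ : Subset n) → restrict C (S ∪ S′) ≡ restrict C S ∪ restrict C S′
restrict-∪ []          []      []        = refl
restrict-∪ (true  ∷ C) (_ ∷ S) (_ ∷ S′) = cong (_ ∷_) (restrict-∪ C S S′)
restrict-∪ (false ∷ C) (_ ∷ S) (_ ∷ S′) = restrict-∪ C S S′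

restrict-⊥ : (C : Subset n) → restrict C ⊥ ≡ ⊥
restrict-⊥ []          = refl
restrict-⊥ (true  ∷ C) = cong (false ∷_) (restrict-⊥ C)
restrict-⊥ (false ∷ C) = restrict-⊥ C

restrict-⁅⁆ : (C : Subset n) (i : Fin ∣ C ∣) → restrict C ⁅ element C i ⁆ ≡ ⁅ i ⁆
restrict-⁅⁆ (true  ∷ C) zero    = cong (true ∷_) (restrict-⊥ C)
restrict-⁅⁆ (true  ∷ C) (suc i) = cong (false ∷_) (restrict-⁅⁆ C i)
restrict-⁅⁆ (false ∷ C) i       = restrict-⁅⁆ C i

∈-restrict : (C : Subset n) {S : Subset n} {i : Fin ∣ C ∣} → element C i ∈ S → i ∈ restrict C S
∈-restrict (true  ∷ C) {_ ∷ S} {zero}  here      = here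
∈-restrict (true  ∷ C) {_ ∷ S} {suc i} (there x) = there (∈-restrict C x)
∈-restrict (false ∷ C) {_ ∷ S}         (there x) = ∈-restrict C x

∈-extend : (C : Subset n) {P : Subset ∣ C ∣} {i : Fin ∣ C ∣} → i ∈ P → element C i ∈ extend C P
∈-extend (true  ∷ C) {_ ∷ P} here        = here
∈-extend (true  ∷ C) {_ ∷ P} (there i∈P) = there (∈-extend C i∈P)
∈-extend (false ∷ C)         i∈P         = there (∈-extend C i∈P)

Nonempty-∩⇒restrict : (C : Subset n) {S : Subset n} → Nonempty (S ∩ C) → Nonempty (restrict C S)
Nonempty-∩⇒restrict C {S} (x , x∈) with x∈p∩q⁻ S C x∈
... | x∈S , x∈C with ∈⇒element C x∈C
... | i , refl = i , ∈-restrict C x∈S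

Nonempty⇒≢⊥ : {P : Subset n} → Nonempty P → P ≢ ⊥
Nonempty⇒≢⊥ (_ , x∈P) refl = ∉⊥ x∈P

-- Neighbourhoods, their traces on a code, and upper bounds on the order.

module _ (G : Graph) where
  open Graph G

  ∈N : ∀ {u v} → Adj u v → v ∈ N u
  ∈N = ∈-tabulate⁺

  N∋ : ∀ {u v} → v ∈ N u → Adj u v
  N∋ = ∈-tabulate⁻

  Adj-sym : ∀ {u v} → Adj u v → Adj v u
  Adj-sym {u} {v} = subst T (symmetric u v)

  Adj-irrefl : ∀ {v} → ¬ Adj v v
  Adj-irrefl {v} = subst T (irreflexive v)

  v∈N[v] : ∀ v → v ∈ N[ v ]
  v∈N[v] v = q⊆p∪q (N v) ⁅ v ⁆ (x∈⁅x⁆ v)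

  N⊆N[] : ∀ v → N v ⊆ N[ v ]
  N⊆N[] v = p⊆p∪q ⁅ v ⁆

  N[]⁻ : ∀ {v w} → w ∈ N[ v ] → w ≢ v → Adj v w
  N[]⁻ {v} w∈ w≢v with x∈p∪q⁻ (N v) ⁅ v ⁆ w∈
  ... | inj₁ w∈N = N∋ w∈N
  ... | inj₂ w∈⁅v⁆ = contradiction (x∈⁅y⁆⇒x≡y v w∈⁅v⁆) w≢v

  N[]∩≡N∩ : ∀ {C v} → v ∉ C → N[ v ] ∩ C ≡ N v ∩ C
  N[]∩≡N∩ {C} {v} v∉C = ⊆-antisym ⊆ˡ ⊆ʳ
    where
    ⊆ˡ : N[ v ] ∩ C ⊆ N v ∩ C
    ⊆ˡ x∈ with x∈p∩q⁻ N[ v ] C x∈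
    ... | x∈N , x∈C = x∈p∩q⁺ (∈N (N[]⁻ x∈N λ { refl → v∉C x∈C }) , x∈C)
    ⊆ʳ : N v ∩ C ⊆ N[ v ] ∩ C
    ⊆ʳ x∈ with x∈p∩q⁻ (N v) C x∈
    ... | x∈N , x∈C = x∈p∩q⁺ (N⊆N[] v x∈N , x∈C)

  -- If the traces agreed, `u` would lie in both, so `v` would be adjacent to `u`. Then `v` in `C`
  -- would put `v` into its own open neighbourhood; and for `v` outside `C` the open and closed
  -- traces of `v` coincide, so the closed neighbourhoods of `u` and `v` would not be separated.
  open≢closed : ∀ {C} → FullSeparating C → ∀ {u v} → u ∈ C → N v ∩ C ≢ N[ u ] ∩ C
  open≢closed {C} separating {u} {v} u∈C eq = proj₂ (separating v u v≢u) (trans (N[]∩≡N∩ v∉C) eq)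
    where
    v∼u : Adj v u
    v∼u = N∋ (p∩q⊆p (N v) C (subst (u ∈_) (sym eq) (x∈p∩q⁺ (v∈N[v] u , u∈C))))
    v≢u : v ≢ u
    v≢u refl = Adj-irrefl v∼u
    v∉C : v ∉ C
    v∉C v∈C = Adj-irrefl (N∋ (p∩q⊆p (N v) C
      (subst (v ∈_) (sym eq) (x∈p∩q⁺ (N⊆N[] u (∈N (Adj-sym v∼u)) , v∈C)))))

  -- Equal open neighbourhoods already force non-adjacency: a neighbour `v` of `u` would be its own
  -- neighbour.
  twinFree⇒N≢ : TwinFree G → ∀ {u v} → u ≢ v → N u ≢ N v
  twinFree⇒N≢ twinFree {u} {v} u≢v eq = proj₁ (twinFree u v)
    (u≢v , (λ u∼v → Adj-irrefl (N∋ (subst (v ∈_) eq (∈N u∼v)))) , eq)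

  twinFree⇒N[]≢ : TwinFree G → ∀ {u v} → u ≢ v → N[ u ] ≢ N[ v ]
  twinFree⇒N[]≢ twinFree {u} {v} u≢v eq = proj₂ (twinFree u v)
    (u≢v , N[]⁻ (subst (v ∈_) (sym eq) (v∈N[v] v)) (u≢v ∘ sym) , eq)

  ¬isolated⇒Nonempty : ¬ HasIsolatedVertex G → ∀ v → Nonempty (N v)
  ¬isolated⇒Nonempty ¬isolated v = decidable-stable (nonempty? (N v)) λ empty → ¬isolated (v , empty)

  -- The set of all vertices serves as the code; conversely, an isolated vertex has no neighbour in
  -- any code.
  ¬isolated⇔FTD-admissible : TwinFree G → (¬ HasIsolatedVertex G) ⇔ Admissible FTD G
  ¬isolated⇔FTD-admissible twinFree = mk⇔
    (λ ¬isolated → ⊤ ,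
      (λ u v u≢v →
        (λ eq → twinFree⇒N≢ twinFree u≢v (trans (sym (∩-identityʳ _)) (trans eq (∩-identityʳ _)))) ,
        (λ eq → twinFree⇒N[]≢ twinFree u≢v (trans (sym (∩-identityʳ _)) (trans eq (∩-identityʳ _))))) ,
      (λ v → let w , w∈N = ¬isolated⇒Nonempty ¬isolated v in w , x∈p∩q⁺ (w∈N , ∈⊤)))
    (λ { (C , _ , total) (v , isolated) → let w , w∈ = total v in
      isolated (w , p∩q⊆p (N v) C w∈) })

  FTD⇒FD : ∀ {C} → IsCode FTD G C → IsCode FD G C
  FTD⇒FD {C} (separating , total) = separating , λ v → let w , w∈ = total v
                                                           w∈N , w∈C = x∈p∩q⁻ (N v) C w∈
                                                       in w , x∈p∩q⁺ (N⊆N[] v w∈N , w∈C)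

  restrict-N : ∀ C i → restrict C (N (element C i)) ≡ Graph.N (induced G C) i
  restrict-N C i = restrict-tabulate C (adjacent (element C i))

  restrict-N[] : ∀ C i → restrict C N[ element C i ] ≡ Graph.N[_] (induced G C) i
  restrict-N[] C i = trans (restrict-∪ C _ _) (cong₂ _∪_ (restrict-N C i) (restrict-⁅⁆ C i))

  -- Closed neighbourhoods are listed only for vertices of `C`: outside `C` the closed trace repeats
  -- the open one.
  trace : (C : VertexSet) → Vertex ⊎ Fin ∣ C ∣ → Subset ∣ C ∣
  trace C (inj₁ v) = restrict C (N v)
  trace C (inj₂ i) = restrict C N[ element C i ]

  -- The extra index accounts for the empty set. It gains one in the upper bound when no trace is
  -- empty, and completes the list of subsets in the lower bound.
  trace⁺ : (C : VertexSet) → Fin (suc order) ⊎ Fin ∣ C ∣ → Subset ∣ C ∣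
  trace⁺ C (inj₁ zero)    = ⊥
  trace⁺ C (inj₁ (suc v)) = trace C (inj₁ v)
  trace⁺ C (inj₂ i)       = trace C (inj₂ i)

  -- Open against open and closed against closed are the two halves of full separation; the mixed
  -- cases are `open≢closed`.
  trace-injective : ∀ {C} → FullSeparating C → Injective _≡_ _≡_ (trace C)
  trace-injective {C} separating {inj₁ u} {inj₁ v} eq = cong inj₁
    (decidable-stable (u ≟ᶠ v) λ u≢v → proj₁ (separating u v u≢v) (restrict-≡⇒∩-≡ C eq))
  trace-injective {C} separating {inj₂ i} {inj₂ j} eq = cong inj₂ (element-injective C
    (decidable-stable (_ ≟ᶠ _) λ u≢v → proj₂ (separating _ _ u≢v) (restrict-≡⇒∩-≡ C eq)))
  trace-injective {C} separating {inj₁ v} {inj₂ i} eq =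
    contradiction (restrict-≡⇒∩-≡ C eq) (open≢closed separating (element-∈ C i))
  trace-injective {C} separating {inj₂ i} {inj₁ v} eq =
    contradiction (restrict-≡⇒∩-≡ C (sym eq)) (open≢closed separating (element-∈ C i))

  trace-nonempty : ∀ {C} → TotalDominating C → ∀ x → trace C x ≢ ⊥
  trace-nonempty {C} total (inj₁ v) = Nonempty⇒≢⊥ (Nonempty-∩⇒restrict C (total v))
  trace-nonempty {C} total (inj₂ i) = Nonempty⇒≢⊥ (i , ∈-restrict C (v∈N[v] (element C i)))

  trace⁺-injective : ∀ {C} → IsCode FTD G C → Injective _≡_ _≡_ (trace⁺ C)
  trace⁺-injective (_ , total) {inj₁ zero}    {inj₁ zero}    eq = refl
  trace⁺-injective (_ , total) {inj₁ zero}    {inj₁ (suc v)} eq = contradiction (sym eq) (trace-nonempty total (inj₁ v))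
  trace⁺-injective (_ , total) {inj₁ zero}    {inj₂ j}       eq = contradiction (sym eq) (trace-nonempty total (inj₂ j))
  trace⁺-injective (_ , total) {inj₁ (suc u)} {inj₁ zero}    eq = contradiction eq (trace-nonempty total (inj₁ u))
  trace⁺-injective (_ , total) {inj₂ i}       {inj₁ zero}    eq = contradiction eq (trace-nonempty total (inj₂ i))
  trace⁺-injective (separating , _) {inj₁ (suc u)} {inj₁ (suc v)} eq with refl ← trace-injective separating {inj₁ u} {inj₁ v} eq = refl
  trace⁺-injective (separating , _) {inj₁ (suc u)} {inj₂ j} eq with () ← trace-injective separating {inj₁ u} {inj₂ j} eq
  trace⁺-injective (separating , _) {inj₂ i} {inj₁ (suc v)} eq with () ← trace-injective separating {inj₂ i} {inj₁ v} eq
  trace⁺-injective (separating , _) {inj₂ i} {inj₂ j} eq with refl ← trace-injective separating {inj₂ i} {inj₂ j} eq = refl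

  FD-bound : ∀ {C} → IsCode FD G C → order + ∣ C ∣ ≤ 2 ^ ∣ C ∣
  FD-bound (separating , _) = injective⇒+≤2^ (trace-injective separating)

  FTD-bound : ∀ {C} → IsCode FTD G C → suc (order + ∣ C ∣) ≤ 2 ^ ∣ C ∣
  FTD-bound {C} code = injective⇒+≤2^ {f = trace⁺ C} (trace⁺-injective code)

-- Codes in the graphs G^F(k), and lower bounds on their order.

module _ {G k C} (gf : IsGF k G C) where
  open Graph G
  open IsGF gf

  -- Two outer vertices are separated by the uniqueness in `vertexOf`, an outer and an inner one by
  -- the definition of an outer trace, and two inner ones by twin-freeness of the induced graph.
  separating : FullSeparating C
  separating u v u≢v with u ∈? C | v ∈? C
  ... | no u∉C  | no v∉C  = N≢ , λ eq → N≢ (trans (sym (N[]∩≡N∩ G u∉C)) (trans eq (N[]∩≡N∩ G v∉C)))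
    where
    N≢ : N u ∩ C ≢ N v ∩ C
    N≢ eq = let _ , _ , unique = vertexOf (N u ∩ C) (outer u u∉C)
            in u≢v (trans (sym (unique (u∉C , refl))) (unique (v∉C , sym eq)))
  ... | yes u∈C | no v∉C  = let N≢ , N[]≢ = proj₂ (proj₂ (outer v v∉C)) u u∈C
                            in N≢ , λ eq → N[]≢ (trans eq (N[]∩≡N∩ G v∉C))
  ... | no u∉C  | yes v∈C = let N≢ , N[]≢ = proj₂ (proj₂ (outer u u∉C)) v v∈C
                            in (N≢ ∘ sym) , λ eq → N[]≢ (trans (sym eq) (N[]∩≡N∩ G u∉C))
  ... | yes u∈C | yes v∈C with ∈⇒element C u∈C | ∈⇒element C v∈C
  ... | i , refl | j , refl =
    (λ eq → twinFree⇒N≢ (induced G C) twinFree i≢j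
      (trans (sym (restrict-N G C i)) (trans (∩-≡⇒restrict-≡ C eq) (restrict-N G C j)))) ,
    (λ eq → twinFree⇒N[]≢ (induced G C) twinFree i≢j
      (trans (sym (restrict-N[] G C i)) (trans (∩-≡⇒restrict-≡ C eq) (restrict-N[] G C j))))
    where
    i≢j : i ≢ j
    i≢j refl = u≢v refl

  GF-FD : IsCode FD G C
  GF-FD = separating , dominating
    where
    dominating : Dominating C
    dominating v with v ∈? C
    ... | yes v∈C = v , x∈p∩q⁺ (v∈N[v] G v , v∈C)
    ... | no  v∉C = subst Nonempty (sym (N[]∩≡N∩ G v∉C)) (proj₁ (proj₂ (outer v v∉C)))

  GF-FTD : ¬ HasIsolatedVertex (induced G C) → IsCode FTD G C
  GF-FTD ¬isolated = separating , total
    where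
    total : TotalDominating C
    total v with v ∈? C
    ... | no  v∉C = proj₁ (proj₂ (outer v v∉C))
    ... | yes v∈C with ∈⇒element C v∈C
    ... | i , refl = let j , j∈N = ¬isolated⇒Nonempty (induced G C) ¬isolated i in
      element C j , x∈p∩q⁺ (∈N G (N∋ (induced G C) j∈N) , element-∈ C j)

  -- A set missed by all neighbourhoods would be an outer trace, and so the open trace of an outer
  -- vertex, which the first search would have found.
  trace-surjective : ∀ P → Nonempty P → ∃[ x ] trace G C x ≡ P
  trace-surjective P (i , i∈P)
    with any? (λ v → restrict C (N v) ≟ P) | any? (λ i → restrict C N[ element C i ] ≟ P)
  ... | yes (v , eq) | _            = inj₁ v , eq
  ... | no _         | yes (i , eq) = inj₂ i , eq
  ... | no ¬open     | no ¬closed   = contradiction (v , back eq) ¬open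
    where
    back : ∀ {S} → S ∩ C ≡ extend C P → restrict C S ≡ P
    back eq = trans (sym (restrict-∩ C _)) (trans (cong (restrict C) eq) (restrict-extend C P))
    new : IsOuterTrace (extend C P)
    new = extend-⊆ C P , (element C i , ∈-extend C i∈P) , λ u u∈C →
      (λ eq → ¬open (u , back eq)) ,
      (λ eq → let j , u≡ = ∈⇒element C u∈C
              in ¬closed (j , back (subst (λ w → N[ w ] ∩ C ≡ extend C P) (sym u≡) eq)))
    v : Vertex
    v = proj₁ (vertexOf _ new)
    eq : N v ∩ C ≡ extend C P
    eq = proj₂ (proj₁ (proj₂ (vertexOf _ new)))

  trace⁺-surjective : ∀ P → ∃[ x ] trace⁺ G C x ≡ P
  trace⁺-surjective P with nonempty? P
  ... | no  empty = inj₁ zero , sym (Empty-unique empty)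
  ... | yes nonempty with trace-surjective P nonempty
  ... | inj₁ v , eq = inj₁ (suc v) , eq
  ... | inj₂ i , eq = inj₂ i , eq

  -- Holds with or without an isolated vertex in `C`, so it serves the minimality of both kinds of
  -- codes.
  GF-bound : 2 ^ k ≤ suc (order + k)
  GF-bound = subst (λ c → 2 ^ c ≤ suc (order + c)) size (surjective⇒2^≤+ trace⁺-surjective)

  GF-bound-isolated : HasIsolatedVertex (induced G C) → 2 ^ k ≤ order + k
  GF-bound-isolated (i , empty) =
    subst (λ c → 2 ^ c ≤ order + c) size (surjective⇒2^≤+ surjective)
    where
    surjective : ∀ P → ∃[ x ] trace G C x ≡ P
    surjective P with nonempty? P
    ... | yes nonempty = trace-surjective P nonempty
    -- The isolated vertex realises the empty trace, so the extra index of `trace⁺` is saved.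
    ... | no  empty′   = inj₁ (element C i) ,
      trans (restrict-N G C i) (trans (Empty-unique empty) (sym (Empty-unique empty′)))

  order-nonZero : 5 ≤ k → NonZero order
  order-nonZero 5≤k = >-nonZero (≤-trans (≤-trans (s≤s z≤n) 5≤k) (subst (_≤ order) size (∣p∣≤n C)))

-- Growth of the powers of two, and minimality of codes.

2^n>n : ∀ n → n < 2 ^ n
2^n>n zero    = s≤s z≤n
2^n>n (suc n) = ≤-trans (+-mono-≤ (m^n>0 2 n) (2^n>n n)) (+-monoʳ-≤ (2 ^ n) (≤-reflexive (sym (+-identityʳ _))))

-- m ↦ 2 ^ m ∸ m is monotone.
2^-minus-mono : m ≤ n → 2 ^ m + n ≤ 2 ^ n + m
2^-minus-mono {m} m≤n with ≤⇒≤′ m≤n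
... | ≤′-refl = ≤-refl
... | ≤′-step {n} m≤′n = begin
  2 ^ m + suc n       ≡⟨ +-suc (2 ^ m) n ⟩
  suc (2 ^ m + n)     ≤⟨ +-mono-≤ (m^n>0 2 n) (2^-minus-mono (≤′⇒≤ m≤′n)) ⟩
  2 ^ n + (2 ^ n + m) ≡⟨ +-assoc (2 ^ n) (2 ^ n) m ⟨
  2 ^ n + 2 ^ n + m   ≡⟨ cong (λ x → 2 ^ n + x + m) (+-identityʳ (2 ^ n)) ⟨
  2 ^ suc n + m       ∎
  where open ≤-Reasoning

-- Put `k = suc p`. If `m ≤ p`, monotonicity lifts `upper` to `n + p ≤ 2 ^ p`; with `lower` this
-- gives `2 ^ p + 2 ^ p ≤ 2 + 2 ^ p`, hence `2 ^ p ≤ 2`, impossible for `4 ≤ p`.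
no-smaller-code : ∀ {k n m} → 5 ≤ k → 2 ^ k ≤ suc (n + k) → n + m ≤ 2 ^ m → k ≤ m
no-smaller-code {suc p} {n} {m} (s≤s 4≤p) lower upper = ≮⇒≥ λ { (s≤s m≤p) →
  let open ≤-Reasoning
      n+p≤2^p : n + p ≤ 2 ^ p
      n+p≤2^p = +-cancelʳ-≤ m _ _ (begin
        n + p + m   ≡⟨ +-assoc n p m ⟩
        n + (p + m) ≡⟨ cong (n +_) (+-comm p m) ⟩
        n + (m + p) ≡⟨ +-assoc n m p ⟨
        n + m + p   ≤⟨ +-monoˡ-≤ p upper ⟩
        2 ^ m + p   ≤⟨ 2^-minus-mono m≤p ⟩
        2 ^ p + m   ∎)
      2^p≤2 : 2 ^ p ≤ 2
      2^p≤2 = +-cancelʳ-≤ (2 ^ p) _ _ (begin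
        2 ^ p + 2 ^ p   ≡⟨ cong (2 ^ p +_) (+-identityʳ (2 ^ p)) ⟨
        2 ^ suc p       ≤⟨ lower ⟩
        suc (n + suc p) ≡⟨ cong suc (+-suc n p) ⟩
        2 + (n + p)     ≤⟨ +-monoʳ-≤ 2 n+p≤2^p ⟩
        2 + 2 ^ p       ∎)
  in <⇒≱ (≤-trans (s≤s (≤-trans (s≤s (s≤s z≤n)) 4≤p)) (2^n>n p)) 2^p≤2 }

-- Through `weaken`, the bound for FD-codes excludes smaller codes of either type.
minimum : ∀ X {k G C} → (∀ {D} → IsCode X G D → IsCode FD G D) →
          5 ≤ k → IsGF k G C → IsCode X G C → IsMinimumCode X G C
minimum X {G = G} weaken 5≤k gf code = code , λ D code′ → subst (_≤ ∣ D ∣) (sym (IsGF.size gf))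
  (no-smaller-code 5≤k (GF-bound gf) (FD-bound G (weaken code′)))

-- A density comes with an X-number of its own, which has to be identified with the prescribed `k`.
HasNumber-unique : ∀ X {G m n} → HasNumber X G m → HasNumber X G n → m ≡ n
HasNumber-unique X (C , (code , min) , refl) (D , (code′ , min′) , refl) =
  ≤-antisym (min D code′) (min′ C code)

-- Densities: for a fixed X-number, least density means greatest order.

/-antimonoʳ-≤ : ∀ k {m n} .{{_ : NonZero m}} .{{_ : NonZero n}} → m ≤ n → pos k / n ℚ.≤ pos k / m
-- Unnormalised fractions are compared by cross-multiplication, with no reduction to lowest terms in
-- the way.
/-antimonoʳ-≤ k {suc m} {suc n} m≤n = ℚ.toℚᵘ-cancel-≤ (begin
  ℚ.toℚᵘ (pos k / suc n) ≃⟨ ℚ.toℚᵘ-fromℚᵘ (ℚᵘ.mkℚᵘ (pos k) n) ⟩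
  ℚᵘ.mkℚᵘ (pos k) n      ≤⟨ ℚᵘ.*≤* (subst₂ _≤ℤ_ (pos-* k (suc m)) (pos-* k (suc n)) (+≤+ (*-monoʳ-≤ k m≤n))) ⟩
  ℚᵘ.mkℚᵘ (pos k) m      ≃⟨ ℚ.toℚᵘ-fromℚᵘ (ℚᵘ.mkℚᵘ (pos k) m) ⟨
  ℚ.toℚᵘ (pos k / suc m) ∎)
  where open ℚᵘ.≤-Reasoning

attains-minimum-density : ∀ X {k} G → NonZero (Graph.order G) → HasNumber X G k →
  (∀ H → HasNumber X H k → Graph.order H ≤ Graph.order G) → AttainsMinimumDensity X k G
attains-minimum-density X {k} G nz number largest =
  number , _ , (k , number , nz , refl) , λ { H _ number′ (m , number″ , nz′ , refl) →
    subst (λ l → _ ℚ.≤ _/_ (pos l) (Graph.order H) {{nz′}}) (HasNumber-unique X number′ number″)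
      (/-antimonoʳ-≤ k {{nz′}} {{nz}} (largest H number′)) }

-- Subsets of a disjoint union, and the construction of graphs G^F(k).

∩⊤++⊥ : (P : Subset m) (Q : Subset n) → (P ++ Q) ∩ (⊤ {m} ++ ⊥ {n}) ≡ P ++ ⊥
∩⊤++⊥ P Q = trans (zipWith-++ _∧_ P Q ⊤ ⊥) (cong₂ _++_ (∩-identityʳ P) (∩-zeroʳ Q))

⊥-++ : ∀ m n → ⊥ {m + n} ≡ ⊥ {m} ++ ⊥ {n}
⊥-++ zero    n = refl
⊥-++ (suc m) n = cong (false ∷_) (⊥-++ m n)

⁅↑ˡ⁆ : (i : Fin m) (n : ℕ) → ⁅ i ↑ˡ n ⁆ ≡ ⁅ i ⁆ ++ ⊥ {n}
⁅↑ˡ⁆ {suc m} zero    n = cong (true ∷_) (⊥-++ m n)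
⁅↑ˡ⁆ {suc m} (suc i) n = cong (false ∷_) (⁅↑ˡ⁆ i n)

∣⊤++⊥∣≡m : ∀ m n → ∣ ⊤ {m} ++ ⊥ {n} ∣ ≡ m
∣⊤++⊥∣≡m zero    n = ∣⊥∣≡0 n
∣⊤++⊥∣≡m (suc m) n = cong suc (∣⊤++⊥∣≡m m n)

tabulate-splitAt : ∀ {m n} {A : Set} (f : Fin m ⊎ Fin n → A) →
  tabulate (f ∘ splitAt m) ≡ tabulate (f ∘ inj₁) ++ tabulate (f ∘ inj₂)
tabulate-splitAt {zero}  f = refl
tabulate-splitAt {suc m} f = cong (_ ∷_) (tabulate-splitAt (f ∘ Sum.map₁ suc))

↑-cases : ∀ m {n} (x : Fin (m + n)) → (∃[ i ] i ↑ˡ n ≡ x) ⊎ (∃[ a ] m ↑ʳ a ≡ x)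
↑-cases m {n} x with splitAt m x | join-splitAt m n x
... | inj₁ i | eq = inj₁ (i , eq)
... | inj₂ a | eq = inj₂ (a , eq)

∈-++ˡ⁺ : {P : Subset m} {Q : Subset n} {i : Fin m} → i ∈ P → i ↑ˡ n ∈ P ++ Q
∈-++ˡ⁺ {P = P} {Q} {i} i∈P = lookup⇒[]= _ _ (trans (lookup-++ˡ P Q i) ([]=⇒lookup i∈P))

∈-++ˡ⁻ : {P : Subset m} {Q : Subset n} {i : Fin m} → i ↑ˡ n ∈ P ++ Q → i ∈ P
∈-++ˡ⁻ {P = P} {Q} {i} i∈ = lookup⇒[]= _ _ (trans (sym (lookup-++ˡ P Q i)) ([]=⇒lookup i∈))

↑ʳ∉++⊥ : {P : Subset m} {a : Fin n} → m ↑ʳ a ∉ P ++ ⊥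
↑ʳ∉++⊥ {P = P} {a} a∈ = ∉⊥ (lookup⇒[]= a ⊥ (trans (sym (lookup-++ʳ P ⊥ a)) ([]=⇒lookup a∈)))

-- Every twin-free graph H is the graph induced by C in some graph G^F(k): the outer vertices stand
-- for the non-empty sets of vertices of H that are not a neighbourhood in H, and are made independent.
module Extension (H : Graph) (twinFreeH : TwinFree H) where
  open Graph H using () renaming (order to k; adjacent to adjacentH; N to NH; N[_] to NH[_])

  -- The condition for an outer trace, read in `H` before the larger graph exists.
  IsNew : Subset k → Set
  IsNew P = Nonempty P × (∀ u → NH u ≢ P × NH[ u ] ≢ P)

  IsNew? : ∀ P → Dec (IsNew P)
  IsNew? P = nonempty? P ×-dec all? λ u → ¬? (NH u ≟ P) ×-dec ¬? (NH[ u ] ≟ P)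

  -- Collecting codes lets `element` enumerate the new sets without repetition, so that outer
  -- vertices are indexed by `Fin ℓ`.
  newCodes : Subset (2 ^ k)
  newCodes = tabulate λ c → isYes (IsNew? (decode c))

  ℓ : ℕ
  ℓ = ∣ newCodes ∣

  newSet : Fin ℓ → Subset k
  newSet a = decode (element newCodes a)

  newSet-new : ∀ a → IsNew (newSet a)
  newSet-new a = toWitness (∈-tabulate⁻ (element-∈ newCodes a))

  newSet-injective : Injective _≡_ _≡_ newSet
  newSet-injective eq = element-injective newCodes (decode-injective {k} eq)

  newSet-surjective : ∀ {P} → IsNew P → ∃[ a ] newSet a ≡ P
  newSet-surjective {P} new =
    let a , eq = ∈⇒element newCodes {encode P}
                   (∈-tabulate⁺ (fromWitness (subst IsNew (sym (decode-encode P)) new)))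
    in a , trans (cong decode eq) (decode-encode P)

  adjacent⊎ : Fin k ⊎ Fin ℓ → Fin k ⊎ Fin ℓ → Bool
  adjacent⊎ (inj₁ i) (inj₁ j) = adjacentH i j
  adjacent⊎ (inj₁ i) (inj₂ a) = lookup (newSet a) i
  adjacent⊎ (inj₂ a) (inj₁ i) = lookup (newSet a) i
  adjacent⊎ (inj₂ _) (inj₂ _) = false

  symmetric⊎ : ∀ u v → adjacent⊎ u v ≡ adjacent⊎ v u
  symmetric⊎ (inj₁ i) (inj₁ j) = Graph.symmetric H i j
  symmetric⊎ (inj₁ _) (inj₂ _) = refl
  symmetric⊎ (inj₂ _) (inj₁ _) = refl
  symmetric⊎ (inj₂ _) (inj₂ _) = refl

  irreflexive⊎ : ∀ v → adjacent⊎ v v ≡ false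
  irreflexive⊎ (inj₁ i) = Graph.irreflexive H i
  irreflexive⊎ (inj₂ _) = refl

  G : Graph
  G = record
    { order       = k + ℓ
    ; adjacent    = λ u v → adjacent⊎ (splitAt k u) (splitAt k v)
    ; symmetric   = λ u v → symmetric⊎ (splitAt k u) (splitAt k v)
    ; irreflexive = λ v → irreflexive⊎ (splitAt k v)
    }

  open Graph G using (N; N[_]; Adj)

  C : Subset (k + ℓ)
  C = ⊤ {k} ++ ⊥ {ℓ}

  ↑ˡ∈C : ∀ i → i ↑ˡ ℓ ∈ C
  ↑ˡ∈C i = ∈-++ˡ⁺ ∈⊤

  ∈C⇒↑ˡ : ∀ {x} → x ∈ C → ∃[ i ] i ↑ˡ ℓ ≡ x
  ∈C⇒↑ˡ {x} x∈C with ↑-cases k x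
  ... | inj₁ inner = inner
  ... | inj₂ (a , refl) = contradiction x∈C (↑ʳ∉++⊥ {P = ⊤ {k}} {a})

  ∉C⇒↑ʳ : ∀ {x} → x ∉ C → ∃[ a ] k ↑ʳ a ≡ x
  ∉C⇒↑ʳ {x} x∉C with ↑-cases k x
  ... | inj₁ (i , refl) = contradiction (↑ˡ∈C i) x∉C
  ... | inj₂ outer = outer

  N-↑ˡ : ∀ i → N (i ↑ˡ ℓ) ≡ NH i ++ tabulate (λ a → lookup (newSet a) i)
  N-↑ˡ i rewrite splitAt-↑ˡ k i ℓ = tabulate-splitAt (adjacent⊎ (inj₁ i))

  N-↑ˡ∩C : ∀ i → N (i ↑ˡ ℓ) ∩ C ≡ NH i ++ ⊥
  N-↑ˡ∩C i = trans (cong (_∩ C) (N-↑ˡ i)) (∩⊤++⊥ (NH i) _)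

  N[]-↑ˡ∩C : ∀ i → N[ i ↑ˡ ℓ ] ∩ C ≡ NH[ i ] ++ ⊥
  N[]-↑ˡ∩C i = trans (cong (_∩ C) (trans (cong₂ _∪_ (N-↑ˡ i) (⁅↑ˡ⁆ i ℓ)) (zipWith-++ _∨_ (NH i) _ ⁅ i ⁆ ⊥)))
    (∩⊤++⊥ NH[ i ] _)

  N-↑ʳ∩C : ∀ a → N (k ↑ʳ a) ∩ C ≡ newSet a ++ ⊥
  N-↑ʳ∩C a rewrite splitAt-↑ʳ k ℓ a = trans
    (cong (_∩ C) (trans (tabulate-splitAt {k} {ℓ} (adjacent⊎ (inj₂ a)))
      (cong (_++ tabulate {ℓ} (λ _ → false)) (tabulate∘lookup (newSet a)))))
    (∩⊤++⊥ (newSet a) _)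

  -- Restates `IsOuterTrace`, which as a member of `IsGF` presupposes the record under construction.
  OuterTrace : Subset (k + ℓ) → Set
  OuterTrace S = S ⊆ C × Nonempty S × (∀ u → u ∈ C → N u ∩ C ≢ S × N[ u ] ∩ C ≢ S)

  new⇒outerTrace : ∀ {P} → IsNew P → OuterTrace (P ++ ⊥)
  new⇒outerTrace {P} ((i , i∈P) , P≢) =
    (λ x∈ → p∩q⊆q (P ++ ⊥) C (subst (_ ∈_) (sym (∩⊤++⊥ P ⊥)) x∈)) , (i ↑ˡ ℓ , ∈-++ˡ⁺ i∈P) , S≢
    where
    S≢ : ∀ u → u ∈ C → N u ∩ C ≢ P ++ ⊥ × N[ u ] ∩ C ≢ P ++ ⊥
    S≢ u u∈C with ∈C⇒↑ˡ u∈C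
    ... | i , refl =
      (λ eq → proj₁ (P≢ i) (++-injectiveˡ _ _ (trans (sym (N-↑ˡ∩C i)) eq))) ,
      (λ eq → proj₂ (P≢ i) (++-injectiveˡ _ _ (trans (sym (N[]-↑ˡ∩C i)) eq)))

  outerTrace⇒new : ∀ {S} → OuterTrace S → ∃[ P ] S ≡ P ++ ⊥ × IsNew P
  outerTrace⇒new {S} (S⊆C , (x , x∈S) , S≢) with Vec.splitAt k S
  ... | P , Q , refl = P , S≡P++⊥ , nonempty ,
    λ i → (λ eq → proj₁ (S≢ _ (↑ˡ∈C i)) (trans (N-↑ˡ∩C i) (trans (cong (_++ ⊥) eq) (sym S≡P++⊥)))) ,
          (λ eq → proj₂ (S≢ _ (↑ˡ∈C i)) (trans (N[]-↑ˡ∩C i) (trans (cong (_++ ⊥) eq) (sym S≡P++⊥))))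
    where
    -- Since `S` lies in `C`, it equals `S ∩ C`, and intersecting with `C` erases the outer half.
    S≡P++⊥ : P ++ Q ≡ P ++ ⊥
    S≡P++⊥ = trans (⊆-antisym (λ y∈S → x∈p∩q⁺ (y∈S , S⊆C y∈S)) (p∩q⊆p (P ++ Q) C)) (∩⊤++⊥ P Q)
    nonempty : Nonempty P
    nonempty with ∈C⇒↑ˡ (S⊆C x∈S)
    ... | i , refl = i , ∈-++ˡ⁻ x∈S

  -- The order `∣ C ∣` of the induced graph is `k` only propositionally, so its vertices are matched
  -- with those of `H` through their images in `G`.
  element-inner : ∀ i → ∃[ j ] j ↑ˡ ℓ ≡ element C i
  element-inner i = ∈C⇒↑ˡ (element-∈ C i)

  twinFree : TwinFree (induced G C)
  twinFree i j with element-inner i | element-inner j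
  ... | i′ , i≡ | j′ , j≡ =
    (λ { (i≢j , _ , eq) → twinFree⇒N≢ H twinFreeH (i′≢j′ i≢j) (++-injectiveˡ _ _
      (trans (sym (N-↑ˡ∩C i′)) (trans
        (subst₂ (λ u v → N u ∩ C ≡ N v ∩ C) (sym i≡) (sym j≡)
          (restrict-≡⇒∩-≡ C (trans (restrict-N G C i) (trans eq (sym (restrict-N G C j))))))
        (N-↑ˡ∩C j′)))) }) ,
    (λ { (i≢j , _ , eq) → twinFree⇒N[]≢ H twinFreeH (i′≢j′ i≢j) (++-injectiveˡ _ _
      (trans (sym (N[]-↑ˡ∩C i′)) (trans
        (subst₂ (λ u v → N[ u ] ∩ C ≡ N[ v ] ∩ C) (sym i≡) (sym j≡)
          (restrict-≡⇒∩-≡ C (trans (restrict-N[] G C i) (trans eq (sym (restrict-N[] G C j))))))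
        (N[]-↑ˡ∩C j′)))) })
    where
    i′≢j′ : i ≢ j → i′ ≢ j′
    i′≢j′ i≢j refl = i≢j (element-injective C (trans (sym i≡) j≡))

  outer : ∀ v → v ∉ C → OuterTrace (N v ∩ C)
  outer v v∉C with ∉C⇒↑ʳ v∉C
  ... | a , refl = subst OuterTrace (sym (N-↑ʳ∩C a)) (new⇒outerTrace (newSet-new a))

  vertexOf : ∀ S → OuterTrace S → ∃! _≡_ (λ v → v ∉ C × N v ∩ C ≡ S)
  vertexOf S outerTrace with outerTrace⇒new outerTrace
  ... | P , refl , new with newSet-surjective new
  ... | a , refl = k ↑ʳ a , (↑ʳ∉++⊥ {P = ⊤ {k}} , N-↑ʳ∩C a) , λ (v∉C , eq) → unique v∉C eq
    where
    unique : ∀ {v} → v ∉ C → N v ∩ C ≡ newSet a ++ ⊥ → k ↑ʳ a ≡ v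
    unique v∉C eq with ∉C⇒↑ʳ v∉C
    ... | b , refl = cong (k ↑ʳ_) (newSet-injective (++-injectiveˡ _ _ (trans (sym eq) (N-↑ʳ∩C b))))

  isGF : IsGF k G C
  isGF = record { size = ∣⊤++⊥∣≡m k ℓ ; twinFree = twinFree ; outer = outer ; vertexOf = vertexOf }

  Adj-↑ˡ : ∀ i j → Adj (i ↑ˡ ℓ) (j ↑ˡ ℓ) ≡ Graph.Adj H i j
  Adj-↑ˡ i j rewrite splitAt-↑ˡ k i ℓ | splitAt-↑ˡ k j ℓ = refl

  isolated : HasIsolatedVertex H → HasIsolatedVertex (induced G C)
  isolated (i , empty) with ∈⇒element C (↑ˡ∈C i)
  ... | i′ , i≡ = i′ , λ (j′ , j′∈N) →
    let j , j≡ = element-inner j′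
    in empty (j , ∈N H (subst id (Adj-↑ˡ i j) (subst₂ Adj i≡ (sym j≡) (N∋ (induced G C) j′∈N))))

  ¬isolated : ¬ HasIsolatedVertex H → ¬ HasIsolatedVertex (induced G C)
  ¬isolated ¬isolatedH (i′ , empty) =
    let i , i≡ = element-inner i′
        j , j∈N = ¬isolated⇒Nonempty H ¬isolatedH i
        j′ , j≡ = ∈⇒element C (↑ˡ∈C j)
    in empty (j′ , ∈N (induced G C) (subst₂ Adj i≡ (sym j≡) (subst id (sym (Adj-↑ˡ i j)) (N∋ H j∈N))))

-- Paths, and paths with an isolated vertex added.

isZero : Fin n → Bool
isZero zero    = true
isZero (suc _) = false

path-adjacent : Fin n → Fin n → Bool
path-adjacent zero    zero    = false
path-adjacent zero    (suc j) = isZero j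
path-adjacent (suc i) zero    = isZero i
path-adjacent (suc i) (suc j) = path-adjacent i j

path-symmetric : (i j : Fin n) → path-adjacent i j ≡ path-adjacent j i
path-symmetric zero    zero    = refl
path-symmetric zero    (suc j) = refl
path-symmetric (suc i) zero    = refl
path-symmetric (suc i) (suc j) = path-symmetric i j

path-irreflexive : (i : Fin n) → path-adjacent i i ≡ false
path-irreflexive zero    = refl
path-irreflexive (suc i) = path-irreflexive i

path : ℕ → Graph
path n = record
  { order       = n
  ; adjacent    = path-adjacent
  ; symmetric   = path-symmetric
  ; irreflexive = path-irreflexive
  }

path-¬isolated : ∀ n → ¬ HasIsolatedVertex (path (2 + n))
path-¬isolated n (i , empty) = let j , i∼j = neighbour i in empty (j , ∈N (path (2 + n)) {i} {j} i∼j)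
  where
  neighbour : ∀ {n} (i : Fin (2 + n)) → ∃[ j ] T (path-adjacent i j)
  neighbour zero                = suc zero , _
  neighbour (suc zero)          = zero , _
  neighbour {suc n} (suc (suc i)) = let j , i∼j = neighbour {n} (suc i) in suc j , i∼j

-- P₃ has open twins, hence at least four vertices here.
path-open-separated : (i j : Fin (4 + n)) → i ≢ j → ∃[ w ] path-adjacent i w ≢ path-adjacent j w
path-open-separated zero zero i≢j = contradiction refl i≢j
path-open-separated zero (suc zero) _ = zero , λ ()
-- Vertex 1 is a common neighbour of 0 and 2, so only vertex 3 tells them apart.
path-open-separated zero (suc (suc zero)) _ = suc (suc (suc zero)) , λ ()
path-open-separated zero (suc (suc (suc _))) _ = suc zero , λ ()
path-open-separated (suc zero) zero _ = zero , λ ()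
path-open-separated (suc (suc zero)) zero _ = suc (suc (suc zero)) , λ ()
path-open-separated (suc (suc (suc _))) zero _ = suc zero , λ ()
path-open-separated (suc zero) (suc zero) i≢j = contradiction refl i≢j
path-open-separated (suc zero) (suc (suc zero)) _ = zero , λ ()
path-open-separated (suc zero) (suc (suc (suc _))) _ = zero , λ ()
path-open-separated (suc (suc zero)) (suc zero) _ = zero , λ ()
path-open-separated (suc (suc (suc _))) (suc zero) _ = zero , λ ()
path-open-separated {zero} (suc (suc zero)) (suc (suc zero)) i≢j = contradiction refl i≢j
path-open-separated {zero} (suc (suc zero)) (suc (suc (suc zero))) _ = suc (suc zero) , λ ()
path-open-separated {zero} (suc (suc (suc zero))) (suc (suc zero)) _ = suc (suc zero) , λ ()
path-open-separated {zero} (suc (suc (suc zero))) (suc (suc (suc zero))) i≢j = contradiction refl i≢j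
path-open-separated {suc n} (suc (suc i)) (suc (suc j)) i≢j =
  let w , ≢ = path-open-separated {n} (suc i) (suc j) λ { refl → i≢j refl } in suc w , ≢

-- Adjacent `i` and `j` both belong to both closed neighbourhoods, so the witness must be a third
-- vertex; there, membership in a closed neighbourhood is plain adjacency.
path-closed-separated : (i j : Fin (3 + n)) → T (path-adjacent i j) →
  ∃[ w ] w ≢ i × w ≢ j × path-adjacent i w ≢ path-adjacent j w
path-closed-separated zero (suc zero) _ = suc (suc zero) , (λ ()) , (λ ()) , λ ()
path-closed-separated (suc zero) zero _ = suc (suc zero) , (λ ()) , (λ ()) , λ ()
path-closed-separated (suc zero) (suc (suc zero)) _ = zero , (λ ()) , (λ ()) , λ ()
path-closed-separated (suc (suc zero)) (suc zero) _ = zero , (λ ()) , (λ ()) , λ ()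
path-closed-separated {suc n} (suc (suc i)) (suc (suc j)) i∼j =
  let w , w≢i , w≢j , ≢ = path-closed-separated {n} (suc i) (suc j) i∼j
  in suc w , (λ eq → w≢i (suc-injective eq)) , (λ eq → w≢j (suc-injective eq)) , ≢
path-closed-separated {zero} (suc (suc zero)) (suc (suc zero)) ()

path-twinFree : ∀ n → TwinFree (path (4 + n))
path-twinFree n u v = open-twins , closed-twins
  where
  open Graph (path (4 + n))
  lookup-N : ∀ u w → lookup (N u) w ≡ adjacent u w
  lookup-N u w = lookup∘tabulate (adjacent u) w
  lookup-N[] : ∀ u w → w ≢ u → lookup N[ u ] w ≡ adjacent u w
  lookup-N[] u w w≢u = begin
    lookup N[ u ] w                ≡⟨ lookup-zipWith _∨_ w (N u) ⁅ u ⁆ ⟩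
    lookup (N u) w ∨ lookup ⁅ u ⁆ w ≡⟨ cong (lookup (N u) w ∨_) (∉⇒lookup≡false (x≢y⇒x∉⁅y⁆ w≢u)) ⟩
    lookup (N u) w ∨ false         ≡⟨ ∨-identityʳ _ ⟩
    lookup (N u) w                 ≡⟨ lookup-N u w ⟩
    adjacent u w                   ∎
    where open ≡-Reasoning
  open-twins : ¬ OpenTwins u v
  open-twins (u≢v , _ , eq) = let w , ≢ = path-open-separated u v u≢v in
    ≢ (trans (sym (lookup-N u w)) (trans (cong (λ S → lookup S w) eq) (lookup-N v w)))
  closed-twins : ¬ ClosedTwins u v
  closed-twins (_ , u∼v , eq) = let w , w≢u , w≢v , ≢ = path-closed-separated u v u∼v in
    ≢ (trans (sym (lookup-N[] u w w≢u)) (trans (cong (λ S → lookup S w) eq) (lookup-N[] v w w≢v)))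

add-isolated : Graph → Graph
add-isolated H = record
  { order       = suc order
  ; adjacent    = λ { (suc u) (suc v) → adjacent u v ; _ _ → false }
  ; symmetric   = λ { (suc u) (suc v) → symmetric u v ; zero zero → refl ; zero (suc _) → refl ; (suc _) zero → refl }
  ; irreflexive = λ { (suc v) → irreflexive v ; zero → refl }
  }
  where open Graph H

add-isolated-isolated : ∀ H → HasIsolatedVertex (add-isolated H)
add-isolated-isolated H = zero , λ (w , w∈N) → N∋ (add-isolated H) {zero} {w} w∈N

-- An open twin of the new vertex would be isolated in `H`, and a closed twin would be adjacent to
-- it. For two old vertices, dropping the new entry gives their open or closed neighbourhoods in
-- `H`.
add-isolated-twinFree : ∀ {H} → ¬ HasIsolatedVertex H → TwinFree H → TwinFree (add-isolated H)
add-isolated-twinFree {H} ¬isolated twinFree = λ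
  { zero    zero    → (λ (0≢0 , _) → 0≢0 refl) , (λ (0≢0 , _) → 0≢0 refl)
  ; zero    (suc v) → (λ (_ , _ , eq) → has-neighbour v (sym eq)) , λ ()
  ; (suc u) zero    → (λ (_ , _ , eq) → has-neighbour u eq) , λ ()
  ; (suc u) (suc v) →
    (λ (u≢v , _ , eq) → twinFree⇒N≢ H twinFree (λ { refl → u≢v refl }) (∷-injectiveʳ eq)) ,
    (λ (u≢v , _ , eq) → twinFree⇒N[]≢ H twinFree (λ { refl → u≢v refl }) (∷-injectiveʳ eq))
  }
  where
  H⁺ : Graph
  H⁺ = add-isolated H
  has-neighbour : ∀ v → Graph.N H⁺ (suc v) ≢ Graph.N H⁺ zero
  has-neighbour v eq = let w , w∈N = ¬isolated⇒Nonempty H ¬isolated v in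
    N∋ H⁺ {zero} {suc w} (subst (suc w ∈_) eq (there w∈N))

theorem8 : ∀ (k : ℕ) → 5 ≤ k →
    (∀ G C → IsGF k G C →
    IsMinimumCode FD G C
    × ((¬ HasIsolatedVertex (induced G C)) ⇔ Admissible FTD (induced G C))
    × (¬ HasIsolatedVertex (induced G C) → IsMinimumCode FTD G C))
    × (∃[ G ] ∃[ C ] (IsGF k G C × HasIsolatedVertex (induced G C)))
    × (∀ G C → IsGF k G C → HasIsolatedVertex (induced G C) →
    AttainsMinimumDensity FD k G)
    × (∃[ G ] ∃[ C ] (IsGF k G C × ¬ HasIsolatedVertex (induced G C)))
    × (∀ G C → IsGF k G C → ¬ HasIsolatedVertex (induced G C) →
    AttainsMinimumDensity FTD k G)
theorem8 k@(suc (suc (suc (suc (suc m))))) 5≤k@(s≤s (s≤s (s≤s (s≤s (s≤s z≤n))))) =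
  (λ G C gf → FD-minimum gf , ¬isolated⇔FTD-admissible (induced G C) (IsGF.twinFree gf) , FTD-minimum gf) ,
  (E₁.G , E₁.C , E₁.isGF , E₁.isolated (add-isolated-isolated (path (4 + m)))) ,
  (λ G C gf isolated → attains-minimum-density FD G (order-nonZero gf 5≤k)
    (C , FD-minimum gf , IsGF.size gf)
    -- The order of `H` plus `k` is at most `2 ^ k`, which is at most the order of `G` plus `k`.
    λ { H (D , (code , _) , eq) → +-cancelʳ-≤ k _ _
      (≤-trans (subst (λ c → Graph.order H + c ≤ 2 ^ c) eq (FD-bound H code)) (GF-bound-isolated gf isolated)) }) ,
  (E₂.G , E₂.C , E₂.isGF , E₂.¬isolated (path-¬isolated (3 + m))) ,
  (λ G C gf ¬isolated → attains-minimum-density FTD G (order-nonZero gf 5≤k)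
    (C , FTD-minimum gf ¬isolated , IsGF.size gf)
    -- Both bounds now carry the unit contributed by the empty set, and it cancels.
    λ { H (D , (code , _) , eq) → +-cancelʳ-≤ k _ _ (s≤s⁻¹
      (≤-trans (subst (λ c → suc (Graph.order H + c) ≤ 2 ^ c) eq (FTD-bound H code)) (GF-bound gf))) })
  where
  -- From `5 ≤ k` the path on `k - 1` vertices has at least four, as `path-twinFree` asks.
  module E₁ = Extension (add-isolated (path (4 + m)))
    (add-isolated-twinFree (path-¬isolated (2 + m)) (path-twinFree m))
  module E₂ = Extension (path (5 + m)) (path-twinFree (1 + m))

  FD-minimum : ∀ {G C} → IsGF k G C → IsMinimumCode FD G C
  FD-minimum gf = minimum FD id 5≤k gf (GF-FD gf)

  FTD-minimum : ∀ {G C} → IsGF k G C → ¬ HasIsolatedVertex (induced G C) → IsMinimumCode FTD G C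
  FTD-minimum {G} gf ¬isolated = minimum FTD (FTD⇒FD G) 5≤k gf (GF-FTD gf ¬isolated)
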